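{- Let $\mathbf{R}=\langle R,+,\cdot,0,1,\alpha\rangle$ be an integral involutive near semiring. An element $e\in R$ is central if and only if it satisfies the following equations for all $x,y,z,u\in R$: 1. $(e\cdot\alpha(x))+(\alpha(e)\cdot\alpha(y))=\alpha\big((e\cdot x)+(\alpha(e)\cdot y)\big)$; 2. $(e\cdot(x\cdot z))+(\alpha(e)\cdot(y\cdot u))=\big((e\cdot x)+(\alpha(e)\cdot y)\big)\cdot\big((e\cdot z)+(\alpha(e)\cdot u)\big)$.
   Context: A near semiring is an algebra $\langle R,+,\cdot,0,1\rangle$ such that: (i) $\langle R,+,0\rangle$ is a commutative monoid; (ii) $x\cdot 1=x=1\cdot x$ (multiplication need not be associative or commutative); (iii) $(x+y)\cdot z=(x\cdot z)+(y\cdot z)$; (iv) $x\cdot 0=0\cdot x=0$. It is idempotent if $x+x=x$; then $x\le y$ iff $x+y=y$ defines a partial order, called the induced order. It is integral if $x+1=1$ for all $x$. An involutive near semiring is an idempotent near semiring with a map $\alpha:R\to R$ such that $\alpha(\alpha(x))=x$, and $x\le y$ implies $\alpha(y)\le\alpha(x)$. For $a,b\in R$, $\theta(a,b)$ denotes the congruence of $\mathbf{R}$ (with respect to $+,\cdot,\alpha,0,1$) generated by the pair $(a,b)$. An element $e\in R$ is central if $(\theta(e,0),\theta(e,1))$ is a pair of complementary factor congruences of $\mathbf{R}$, i.e. $\theta(e,0)\cap\theta(e,1)$ is the identity relation and $\theta(e,0)\circ\theta(e,1)=R\times R$. -}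

module Defs where

open import Level using (Level; _⊔_; suc)
open import Data.Product using (_,_)
open import Relation.Binary.Core using (Rel; _⇒_; _⇔_)
open import Relation.Binary.Definitions using (Universal; Antitonic₁)
open import Relation.Binary.Structures using (IsEquivalence)
open import Relation.Binary.Construct.Composition using (_;_)
open import Relation.Binary.Construct.Intersection using (_∩_)
open import Algebra.Core using (Op₁; Op₂)
import Algebra.Definitions as AlgebraDefinitions
open import Algebra.Structures using (IsCommutativeMonoid)

-- Unlike `Algebra.Structures.IsNearSemiring`, multiplication is not assumed
-- associative, while addition is commutative, 1 is a two-sided unit and 0 is
-- a two-sided zero.

record IsNonAssociativeNearSemiring
  {a ℓ} {A : Set a} (_≈_ : Rel A ℓ) (_+_ _*_ : Op₂ A) (0# 1# : A) :
  Set (a ⊔ ℓ) where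
  open AlgebraDefinitions _≈_
  field
    +-isCommutativeMonoid : IsCommutativeMonoid _≈_ _+_ 0#
    *-cong                : Congruent₂ _*_
    *-identity            : Identity 1# _*_
    distribʳ              : _*_ DistributesOverʳ _+_
    zero                  : Zero 0# _*_

  open IsCommutativeMonoid +-isCommutativeMonoid public
    using (isEquivalence; refl; sym; trans; setoid)
    renaming
    ( ∙-cong    to +-cong
    ; assoc     to +-assoc
    ; comm      to +-comm
    ; identity  to +-identity
    ; identityˡ to +-identityˡ
    ; identityʳ to +-identityʳ
    )

record InvolutiveNearSemiring c ℓ : Set (suc (c ⊔ ℓ)) where
  infix  4 _≈_ _≤_
  infixl 6 _+_
  infixl 7 _*_
  field
    Carrier : Set c
    _≈_     : Rel Carrier ℓ
    _+_     : Op₂ Carrier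
    _*_     : Op₂ Carrier
    0#      : Carrier
    1#      : Carrier
    α       : Op₁ Carrier

  open AlgebraDefinitions _≈_

  _≤_ : Rel Carrier ℓ
  x ≤ y = x + y ≈ y

  field
    isNearSemiring : IsNonAssociativeNearSemiring _≈_ _+_ _*_ 0# 1#
    +-idem         : Idempotent _+_
    α-cong         : Congruent₁ α
    α-involutive   : Involutive α
    α-antitone     : Antitonic₁ _≤_ _≤_ α

  open IsNonAssociativeNearSemiring isNearSemiring public

module _ {c ℓ} (R : InvolutiveNearSemiring c ℓ) where
  open InvolutiveNearSemiring R

  Integral : Set (c ⊔ ℓ)
  Integral = ∀ x → x + 1# ≈ 1#

  -- Relations on a setoid must contain the setoid equality to be congruences.

  record IsCongruence {r} (_∼_ : Rel Carrier r) : Set (c ⊔ ℓ ⊔ r) where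
    open AlgebraDefinitions _∼_
    field
      ∼-isEquivalence : IsEquivalence _∼_
      ∼-reflexive     : _≈_ ⇒ _∼_
      ∼-+-cong        : Congruent₂ _+_
      ∼-*-cong        : Congruent₂ _*_
      ∼-α-cong        : Congruent₁ α

  data θ (a b : Carrier) : Rel Carrier (c ⊔ ℓ) where
    generator   : θ a b a b
    θ-reflexive : ∀ {x y} → x ≈ y → θ a b x y
    θ-sym       : ∀ {x y} → θ a b x y → θ a b y x
    θ-trans     : ∀ {x y z} → θ a b x y → θ a b y z → θ a b x z
    θ-+-cong    : ∀ {x y u v} → θ a b x y → θ a b u v → θ a b (x + u) (y + v)
    θ-*-cong    : ∀ {x y u v} → θ a b x y → θ a b u v → θ a b (x * u) (y * v)
    θ-α-cong    : ∀ {x y} → θ a b x y → θ a b (α x) (α y)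

  θ-isCongruence : ∀ a b → IsCongruence (θ a b)
  θ-isCongruence a b = record
    { ∼-isEquivalence = record
      { refl = θ-reflexive refl ; sym = θ-sym ; trans = θ-trans }
    ; ∼-reflexive = θ-reflexive
    ; ∼-+-cong    = θ-+-cong
    ; ∼-*-cong    = θ-*-cong
    ; ∼-α-cong    = θ-α-cong
    }

  θ-least : ∀ {a b r} {_∼_ : Rel Carrier r} →
            IsCongruence _∼_ → a ∼ b → θ a b ⇒ _∼_
  θ-least {a} {b} {_} {_∼_} C a∼b = go
    where
    open IsCongruence C
    open IsEquivalence ∼-isEquivalence
      renaming (sym to ∼-sym; trans to ∼-trans) using ()

    go : θ a b ⇒ _∼_
    go generator       = a∼b
    go (θ-reflexive p) = ∼-reflexive p
    go (θ-sym p)       = ∼-sym (go p)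
    go (θ-trans p q)   = ∼-trans (go p) (go q)
    go (θ-+-cong p q)  = ∼-+-cong (go p) (go q)
    go (θ-*-cong p q)  = ∼-*-cong (go p) (go q)
    go (θ-α-cong p)    = ∼-α-cong (go p)

  -- The composition operator `_;_` is U+037E (Greek question mark), not a
  -- semicolon.

  record AreComplementaryFactorCongruences
    {r s} (φ : Rel Carrier r) (ψ : Rel Carrier s) : Set (c ⊔ ℓ ⊔ r ⊔ s) where
    field
      φ-isCongruence : IsCongruence φ
      ψ-isCongruence : IsCongruence ψ
      ∩-identity     : (φ ∩ ψ) ⇔ _≈_
      ∘-universal    : Universal (φ ; ψ)

  Central : Carrier → Set (c ⊔ ℓ)
  Central e = AreComplementaryFactorCongruences (θ e 0#) (θ e 1#)

{-# OPTIONS --safe #-}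
module Submission where

-- Put q(x , y) = e x + α(e) y. Modulo θ(e , 0) it is y and modulo θ(e , 1) it
-- is x, whence the equations for central e, and, for any e, the composite of
-- the two congruences is universal. Conversely, the equations say that q is
-- compatible with α and multiplication. They give q(x , x) = x and
-- e q(x , y) = e x, and make e commute with every element, so that right
-- distributivity makes multiplication by e additive. Hence e x = e y and
-- α(e) x = α(e) y define congruences; these contain θ(e , 1) and θ(e , 0)
-- respectively and intersect in the identity.

open import Defs
open import Level using (_⊔_)
open import Data.Product using (_×_; _,_; proj₁; proj₂)
open import Function.Bundles using (_⇔_; mk⇔)
open import Relation.Binary.Core using (Rel)
import Relation.Binary.Reasoning.Setoid as SetoidReasoning

module _ {c ℓ} (R : InvolutiveNearSemiring c ℓ) (integral : Integral R) where
  open InvolutiveNearSemiring R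

  *-identityˡ : ∀ x → 1# * x ≈ x
  *-identityˡ = proj₁ *-identity

  *-identityʳ : ∀ x → x * 1# ≈ x
  *-identityʳ = proj₂ *-identity

  zeroˡ : ∀ x → 0# * x ≈ 0#
  zeroˡ = proj₁ zero

  zeroʳ : ∀ x → x * 0# ≈ 0#
  zeroʳ = proj₂ zero

  *-congˡ : ∀ {x y z} → y ≈ z → x * y ≈ x * z
  *-congˡ = *-cong refl

  *-congʳ : ∀ {x y z} → y ≈ z → y * x ≈ z * x
  *-congʳ p = *-cong p refl

  -- Integrality gives `α 0# ≤ 1#`; antitonicity turns this into `α 1# ≤ α (α 0#) ≈ 0#`, and `0#` is
  -- the least element.
  α1≈0 : α 1# ≈ 0#
  α1≈0 = begin
    α 1#              ≈⟨ +-identityʳ (α 1#) ⟨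
    α 1# + 0#         ≈⟨ +-cong refl (α-involutive 0#) ⟨
    α 1# + α (α 0#)   ≈⟨ α-antitone (integral (α 0#)) ⟩
    α (α 0#)          ≈⟨ α-involutive 0# ⟩
    0#                ∎
    where open SetoidReasoning setoid

  α0≈1 : α 0# ≈ 1#
  α0≈1 = trans (α-cong (sym α1≈0)) (α-involutive 1#)

  -- The map q with its second coefficient left free, so that `e` and `α e` can be replaced by
  -- constants modulo a congruence, or exchanged.
  mux : Carrier → Carrier → Carrier → Carrier → Carrier
  mux e f x y = (e * x) + (f * y)

  mux-zeroʳ : ∀ e f x → mux e f x 0# ≈ e * x
  mux-zeroʳ e f x = trans (+-cong refl (zeroʳ f)) (+-identityʳ (e * x))

  mux-0-1 : ∀ x y → mux 0# 1# x y ≈ y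
  mux-0-1 x y = trans (+-cong (zeroˡ x) (*-identityˡ y)) (+-identityˡ y)

  mux-1-0 : ∀ x y → mux 1# 0# x y ≈ x
  mux-1-0 x y = trans (+-cong (*-identityˡ x) (zeroˡ y)) (+-identityʳ x)

  module _ (e : Carrier) where

    mux-cong-θ : ∀ {a b g h} → θ R a b e g → θ R a b (α e) h →
                 ∀ x y → θ R a b (mux e (α e) x y) (mux g h x y)
    mux-cong-θ e∼g αe∼h x y =
      θ-+-cong (θ-*-cong e∼g (θ-reflexive refl))
               (θ-*-cong αe∼h (θ-reflexive refl))

    mux-θ₀ : ∀ x y → θ R e 0# (mux e (α e) x y) y
    mux-θ₀ x y = θ-trans
      (mux-cong-θ generator
        (θ-trans (θ-α-cong generator) (θ-reflexive α0≈1)) x y)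
      (θ-reflexive (mux-0-1 x y))

    mux-θ₁ : ∀ x y → θ R e 1# (mux e (α e) x y) x
    mux-θ₁ x y = θ-trans
      (mux-cong-θ generator
        (θ-trans (θ-α-cong generator) (θ-reflexive α1≈0)) x y)
      (θ-reflexive (mux-1-0 x y))

  CompatibleWithα : Carrier → Carrier → Set (c ⊔ ℓ)
  CompatibleWithα e f = ∀ x y → mux e f (α x) (α y) ≈ α (mux e f x y)

  CompatibleWith* : Carrier → Carrier → Set (c ⊔ ℓ)
  CompatibleWith* e f = ∀ x y z u →
    mux e f (x * z) (y * u) ≈ mux e f x y * mux e f z u

  central⇒compatible : ∀ e → Central R e →
                       CompatibleWithα e (α e) × CompatibleWith* e (α e)
  central⇒compatible e central = compatα , compat*
    where
    open AreComplementaryFactorCongruences central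

    compatα : CompatibleWithα e (α e)
    -- Both sides are congruent to `α y` modulo the first congruence and to `α x` modulo the second.
    compatα x y = proj₁ ∩-identity
      ( θ-trans (mux-θ₀ e _ _) (θ-sym (θ-α-cong (mux-θ₀ e x y)))
      , θ-trans (mux-θ₁ e _ _) (θ-sym (θ-α-cong (mux-θ₁ e x y))) )

    compat* : CompatibleWith* e (α e)
    compat* x y z u = proj₁ ∩-identity
      ( θ-trans (mux-θ₀ e _ _)
          (θ-sym (θ-*-cong (mux-θ₀ e x y) (mux-θ₀ e z u)))
      , θ-trans (mux-θ₁ e _ _)
          (θ-sym (θ-*-cong (mux-θ₁ e x y) (mux-θ₁ e z u))) )

  compatibleWithα-swap : ∀ {e f} → CompatibleWithα e f → CompatibleWithα f e
  compatibleWithα-swap h x y =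
    trans (+-comm _ _) (trans (h y x) (α-cong (+-comm _ _)))

  compatibleWith*-swap : ∀ {e f} → CompatibleWith* e f → CompatibleWith* f e
  compatibleWith*-swap h x y z u =
    trans (+-comm _ _)
      (trans (h y x u z) (*-cong (+-comm _ _) (+-comm _ _)))

  SameMultiple : Carrier → Rel Carrier ℓ
  SameMultiple e x y = e * x ≈ e * y

  -- With f in place of α e the hypotheses are symmetric in e and f.
  module Compatible {e f : Carrier}
    (compatα : CompatibleWithα e f) (compat* : CompatibleWith* e f) where
    open SetoidReasoning setoid

    complement : e + f ≈ 1#
    complement = begin
      e + f                   ≈⟨ +-cong (*-identityʳ e) (*-identityʳ f) ⟨
      mux e f 1# 1#           ≈⟨ +-cong (*-congˡ α0≈1) (*-congˡ α0≈1) ⟨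
      mux e f (α 0#) (α 0#)   ≈⟨ compatα 0# 0# ⟩
      α (mux e f 0# 0#)       ≈⟨ α-cong (trans (mux-zeroʳ e f 0#) (zeroʳ e)) ⟩
      α 0#                    ≈⟨ α0≈1 ⟩
      1#                      ∎

    mux-idem : ∀ x → mux e f x x ≈ x
    mux-idem x = begin
      mux e f x x   ≈⟨ distribʳ x e f ⟨
      (e + f) * x   ≈⟨ *-congʳ complement ⟩
      1# * x        ≈⟨ *-identityˡ x ⟩
      x             ∎

    -- Exhibits `e` as a value of `mux e f`, so that `compat*` applies to products with `e`.
    mux-1-zero : mux e f 1# 0# ≈ e
    mux-1-zero = trans (mux-zeroʳ e f 1#) (*-identityʳ e)

    *-mux : ∀ x y → e * mux e f x y ≈ e * x
    *-mux x y = begin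
      e * mux e f x y               ≈⟨ *-congʳ mux-1-zero ⟨
      mux e f 1# 0# * mux e f x y   ≈⟨ compat* 1# 0# x y ⟨
      mux e f (1# * x) (0# * y)     ≈⟨ +-cong (*-congˡ (*-identityˡ x)) (*-congˡ (zeroˡ y)) ⟩
      mux e f x 0#                  ≈⟨ mux-zeroʳ e f x ⟩
      e * x                         ∎

    -- Both factors of `x * e` are values of `mux e f`, at `(x , x)` and `(1# , 0#)`; `compat*`
    -- multiplies them componentwise.
    commutes : ∀ x → e * x ≈ x * e
    commutes x = begin
      e * x                         ≈⟨ mux-zeroʳ e f x ⟨
      mux e f x 0#                  ≈⟨ +-cong (*-congˡ (*-identityʳ x)) (*-congˡ (zeroʳ x)) ⟨
      mux e f (x * 1#) (x * 0#)     ≈⟨ compat* x x 1# 0# ⟩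
      mux e f x x * mux e f 1# 0#   ≈⟨ *-cong (mux-idem x) mux-1-zero ⟩
      x * e                         ∎

    *-distribˡ : ∀ x y → e * (x + y) ≈ e * x + e * y
    *-distribˡ x y = begin
      e * (x + y)     ≈⟨ commutes (x + y) ⟩
      (x + y) * e     ≈⟨ distribʳ e x y ⟩
      x * e + y * e   ≈⟨ +-cong (commutes x) (commutes y) ⟨
      e * x + e * y   ∎

    *-homo : ∀ x y → e * (x * y) ≈ (e * x) * (e * y)
    *-homo x y = begin
      e * (x * y)                   ≈⟨ mux-zeroʳ e f (x * y) ⟨
      mux e f (x * y) 0#            ≈⟨ +-cong refl (*-congˡ (zeroˡ 0#)) ⟨
      mux e f (x * y) (0# * 0#)     ≈⟨ compat* x 0# y 0# ⟩
      mux e f x 0# * mux e f y 0#   ≈⟨ *-cong (mux-zeroʳ e f x) (mux-zeroʳ e f y) ⟩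
      (e * x) * (e * y)             ∎

    -- Multiplication by `e` erases the second argument of `mux`, which may therefore be chosen as
    -- `α 0#` to let `compatα` pull `α` outside.
    *-α : ∀ x → e * α x ≈ e * α (e * x)
    *-α x = begin
      e * α x                       ≈⟨ *-mux (α x) (α 0#) ⟨
      e * mux e f (α x) (α 0#)      ≈⟨ *-congˡ (compatα x 0#) ⟩
      e * α (mux e f x 0#)          ≈⟨ *-congˡ (α-cong (mux-zeroʳ e f x)) ⟩
      e * α (e * x)                 ∎

    sameMultiple-isCongruence : IsCongruence R (SameMultiple e)
    sameMultiple-isCongruence = record
      { ∼-isEquivalence = record { refl = refl ; sym = sym ; trans = trans }
      ; ∼-reflexive = *-congˡ
      ; ∼-+-cong = λ p q →
          trans (*-distribˡ _ _) (trans (+-cong p q) (sym (*-distribˡ _ _)))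
      ; ∼-*-cong = λ p q →
          trans (*-homo _ _) (trans (*-cong p q) (sym (*-homo _ _)))
      ; ∼-α-cong = λ p →
          trans (*-α _) (trans (*-congˡ (α-cong p)) (sym (*-α _)))
      }

    -- Says that the kernel of multiplication by `e` contains the pair generating θ(e , 1).
    idempotent : e * e ≈ e * 1#
    idempotent = trans (*-congˡ (sym mux-1-zero)) (*-mux 1# 0#)

    orthogonal : e * f ≈ e * 0#
    orthogonal = begin
      e * f                ≈⟨ *-congˡ (*-identityʳ f) ⟨
      e * (f * 1#)         ≈⟨ *-congˡ (+-identityˡ (f * 1#)) ⟨
      -- The summand `0#` becomes `e * 0#`, which exhibits `f` as `mux e f 0# 1#`.
      e * (0# + f * 1#)    ≈⟨ *-congˡ (+-cong (zeroʳ e) refl) ⟨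
      e * mux e f 0# 1#    ≈⟨ *-mux 0# 1# ⟩
      e * 0#               ∎

    sameMultiples⇒≈ : ∀ {x y} → SameMultiple e x y → SameMultiple f x y → x ≈ y
    sameMultiples⇒≈ {x} {y} p q = begin
      x             ≈⟨ mux-idem x ⟨
      mux e f x x   ≈⟨ +-cong p q ⟩
      mux e f y y   ≈⟨ mux-idem y ⟩
      y             ∎

  compatible⇒central : ∀ e → CompatibleWithα e (α e) →
                       CompatibleWith* e (α e) → Central R e
  compatible⇒central e compatα compat* = record
    { φ-isCongruence = θ-isCongruence R e 0#
    ; ψ-isCongruence = θ-isCongruence R e 1#
    ; ∩-identity =
          (λ (p , q) → E.sameMultiples⇒≈
            (θ-least R E.sameMultiple-isCongruence E.idempotent q)
            (θ-least R F.sameMultiple-isCongruence F.orthogonal p))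
        , (λ p → θ-reflexive p , θ-reflexive p)
    -- The arguments are reversed: `mux e (α e) y x` is congruent to `x` modulo θ(e , 0) and to `y`
    -- modulo θ(e , 1).
    ; ∘-universal = λ x y →
        mux e (α e) y x , θ-sym (mux-θ₀ e y x) , mux-θ₁ e y x
    }
    where
    module E = Compatible compatα compat*
    -- After the exchange `orthogonal` reads `α e * e ≈ α e * 0#`, which places the generator of θ(e
    -- , 0) in the kernel of multiplication by `α e`.
    module F = Compatible
      (compatibleWithα-swap compatα) (compatibleWith*-swap compat*)

theorem14 : ∀ {c ℓ} (R : InvolutiveNearSemiring c ℓ) → Integral R →
    let open InvolutiveNearSemiring R in
    (e : Carrier) →
    Central R e ⇔
    ((∀ x y → (e * α x) + (α e * α y) ≈ α ((e * x) + (α e * y)))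
    × (∀ x y z u → (e * (x * z)) + (α e * (y * u)) ≈ ((e * x) + (α e * y)) * ((e * z) + (α e * u))))
theorem14 R integral e = mk⇔
  (central⇒compatible R integral e)
  (λ (compatα , compat*) → compatible⇒central R integral e compatα compat*)
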